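{- Let $\mathcal{H}=(V,\mathcal{E},f)$ be an edge-weighted hypergraph of rank $r$ such that for every $e\in\mathcal{E}$ the edge-weight function $f_e$ is non-decreasing and convex with $f_e(0)=0$. Then the algorithm GDSH-Approx is a $\frac1r$-approximation algorithm for GDSH: the set $S'$ it returns satisfies \[ \frac{F(S')}{|S'|}\ \ge\ \frac1r\max_{\emptyset\ne T\subseteq V}\frac{F(T)}{|T|}. \]
   Context: An edge-weighted hypergraph $\mathcal{H}=(V,\mathcal{E},f)$ consists of a finite nonempty vertex set $V$, a finite nonempty set $\mathcal{E}$ of nonempty subsets of $V$ (hyperedges), and for each $e\in\mathcal{E}$ an edge-weight function $f_e:\{0,\dots,|e|\}\to\mathbb{R}_{\ge 0}$. Its rank is $r=\max_{e\in\mathcal{E}}|e|$. The function $f_e$ is non-decreasing if $f_e(i)\le f_e(i+1)$ for all $i\in\{0,\dots,|e|-1\}$, and convex if $f_e(i)-f_e(i-1)\le f_e(i+1)-f_e(i)$ for all $i\in\{1,\dots,|e|-1\}$. For $S\subseteq V$, $F(S)=\sum_{e\in\mathcal{E}}f_e(|e\cap S|)$. The generalized densest sub-hypergraph problem (GDSH) asks for a nonempty $S\subseteq V$ maximizing $F(S)/|S|$. Algorithm GDSH-Approx: start with $S\leftarrow V$, $S'\leftarrow V$. While $S\ne\emptyset$: choose $v\in\arg\min_{v\in S}\bigl(F(S)-F(S\setminus\{v\})\bigr)$ (ties broken arbitrarily); set $S\leftarrow S\setminus\{v\}$; if $S\neq\emptyset$ and $\frac{F(S)}{|S|}>\frac{F(S')}{|S'|}$,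 set $S'\leftarrow S$. Return $S'$. -}

module Defs where

open import Data.Fin using (Fin; zero; suc; toℕ; fromℕ<)
open import Data.Fin.Subset
  using (Subset; inside; outside; ⊤; _∈_; _∩_; _-_; ∣_∣; Nonempty; Empty)
open import Data.Fin.Subset.Properties
  using (∈⊤; nonempty?; ∣p∩q∣≤∣p∣; x∈p⇒∣p-x∣<∣p∣)
open import Data.Integer using (+_)
open import Data.List using (List; []; _∷_; _++_; map; mapMaybe; foldr; tabulate)
open import Data.List.Extrema.Nat using (max; v≤max⁺)
open import Data.List.Relation.Unary.Any using (here)
import Data.Maybe as Maybe
open import Data.Nat as ℕ using (ℕ; suc; NonZero; s≤s; z≤n)
import Data.Nat.Properties as ℕ
open import Data.Product using (∃; _×_; _,_; proj₁)
open import Data.Rational as ℚ using (ℚ; 0ℚ; 1ℚ; ½)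
import Data.Rational.Properties as ℚ
open import Data.Rational.Solver using (module +-*-Solver)
open import Data.Sum using (inj₁; inj₂)
open import Data.Vec using ([]; _∷_)
import Data.Vec.Functional as Vector
open import Function using (_∘_)
open import Function.Definitions using (Injective)
open import Relation.Binary.PropositionalEquality
  using (_≡_; refl; sym; trans; cong; subst)
open import Relation.Nullary using (¬_)
open import Relation.Nullary.Decidable using (dec⇒maybe)

-- Real numbers are Cauchy sequences of rationals.  No rate of convergence
-- is prescribed, so that all operations can be taken pointwise.

IsCauchy : (ℕ → ℚ) → Set
IsCauchy x = ∀ ε → 0ℚ ℚ.< ε →
  ∃ λ N → ∀ m n → N ℕ.≤ m → N ℕ.≤ n → ℚ.∣ x m ℚ.- x n ∣ ℚ.≤ ε

record ℝ : Set where
  constructor mkℝ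
  field
    seq    : ℕ → ℚ
    cauchy : IsCauchy seq

open ℝ public

infix  4 _≤ℝ_ _<ℝ_ _≈ℝ_
infixl 6 _+ℝ_ _-ℝ_ _⊔ℝ_
infixl 7 _÷ℝ_

_≤ℝ_ : ℝ → ℝ → Set
x ≤ℝ y = ∀ ε → 0ℚ ℚ.< ε → ∃ λ N → ∀ n → N ℕ.≤ n → seq x n ℚ.≤ seq y n ℚ.+ ε

_<ℝ_ : ℝ → ℝ → Set
x <ℝ y = ∃ λ ε → 0ℚ ℚ.< ε × ∃ λ N → ∀ n → N ℕ.≤ n → seq x n ℚ.+ ε ℚ.≤ seq y n

_≈ℝ_ : ℝ → ℝ → Set
x ≈ℝ y = x ≤ℝ y × y ≤ℝ x

module CauchyProperties where

  ∣p-q∣≤ε⇒p≤q+ε : ∀ p q {ε} → ℚ.∣ p ℚ.- q ∣ ℚ.≤ ε → p ℚ.≤ q ℚ.+ ε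
  ∣p-q∣≤ε⇒p≤q+ε p q {ε} h = begin
    p                      ≡⟨ solve 2 (λ p q → p := q :+ (p :- q)) refl p q ⟩
    q ℚ.+ (p ℚ.- q)        ≤⟨ ℚ.+-monoʳ-≤ q (r≤∣r∣ (p ℚ.- q)) ⟩
    q ℚ.+ ℚ.∣ p ℚ.- q ∣    ≤⟨ ℚ.+-monoʳ-≤ q h ⟩
    q ℚ.+ ε                ∎
    where
    open ℚ.≤-Reasoning
    open +-*-Solver
    r≤∣r∣ : ∀ r → r ℚ.≤ ℚ.∣ r ∣
    r≤∣r∣ r with ℚ.≤-total 0ℚ r
    ... | inj₁ 0≤r = ℚ.≤-reflexive (sym (ℚ.0≤p⇒∣p∣≡p 0≤r))
    ... | inj₂ r≤0 = ℚ.≤-trans r≤0 (ℚ.0≤∣p∣ r)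

  p≤q+ε∧q≤p+ε⇒∣p-q∣≤ε : ∀ p q {ε} → p ℚ.≤ q ℚ.+ ε → q ℚ.≤ p ℚ.+ ε →
                        ℚ.∣ p ℚ.- q ∣ ℚ.≤ ε
  p≤q+ε∧q≤p+ε⇒∣p-q∣≤ε p q {ε} h₁ h₂ with ℚ.∣p∣≡p∨∣p∣≡-p (p ℚ.- q)
  ... | inj₁ eq = subst (ℚ._≤ ε) (sym eq) (begin
    p ℚ.- q            ≤⟨ ℚ.+-monoˡ-≤ (ℚ.- q) h₁ ⟩
    (q ℚ.+ ε) ℚ.- q    ≡⟨ solve 2 (λ q e → (q :+ e) :- q := e) refl q ε ⟩
    ε                  ∎)
    where
    open ℚ.≤-Reasoning
    open +-*-Solver
  ... | inj₂ eq = subst (ℚ._≤ ε) (sym eq) (begin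
    ℚ.- (p ℚ.- q)      ≡⟨ solve 2 (λ p q → :- (p :- q) := q :- p) refl p q ⟩
    q ℚ.- p            ≤⟨ ℚ.+-monoˡ-≤ (ℚ.- p) h₂ ⟩
    (p ℚ.+ ε) ℚ.- p    ≡⟨ solve 2 (λ p e → (p :+ e) :- p := e) refl p ε ⟩
    ε                  ∎)
    where
    open ℚ.≤-Reasoning
    open +-*-Solver

  0<½*ε : ∀ {ε} → 0ℚ ℚ.< ε → 0ℚ ℚ.< ½ ℚ.* ε
  0<½*ε {ε} 0<ε = subst (ℚ._< ½ ℚ.* ε) (ℚ.*-zeroʳ ½) (ℚ.*-monoʳ-<-pos ½ 0<ε)

  ½*ε+½*ε≡ε : ∀ ε → ½ ℚ.* ε ℚ.+ ½ ℚ.* ε ≡ ε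
  ½*ε+½*ε≡ε ε = trans (sym (ℚ.*-distribʳ-+ ε ½ ½)) (ℚ.*-identityˡ ε)

  +-cauchy : ∀ {x y} → IsCauchy x → IsCauchy y → IsCauchy (λ n → x n ℚ.+ y n)
  +-cauchy {x} {y} cx cy ε 0<ε with cx (½ ℚ.* ε) (0<½*ε 0<ε) | cy (½ ℚ.* ε) (0<½*ε 0<ε)
  ... | N , hx | M , hy = N ℕ.⊔ M , λ m n Nm Nn → begin
    ℚ.∣ (x m ℚ.+ y m) ℚ.- (x n ℚ.+ y n) ∣
      ≡⟨ cong ℚ.∣_∣ (solve 4 (λ a b c d → (a :+ b) :- (c :+ d) := (a :- c) :+ (b :- d))
                              refl (x m) (y m) (x n) (y n)) ⟩
    ℚ.∣ (x m ℚ.- x n) ℚ.+ (y m ℚ.- y n) ∣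
      ≤⟨ ℚ.∣p+q∣≤∣p∣+∣q∣ (x m ℚ.- x n) (y m ℚ.- y n) ⟩
    ℚ.∣ x m ℚ.- x n ∣ ℚ.+ ℚ.∣ y m ℚ.- y n ∣
      ≤⟨ ℚ.+-mono-≤ (hx m n (ℕ.m⊔n≤o⇒m≤o N M Nm) (ℕ.m⊔n≤o⇒m≤o N M Nn))
                    (hy m n (ℕ.m⊔n≤o⇒n≤o N M Nm) (ℕ.m⊔n≤o⇒n≤o N M Nn)) ⟩
    ½ ℚ.* ε ℚ.+ ½ ℚ.* ε
      ≡⟨ ½*ε+½*ε≡ε ε ⟩
    ε ∎
    where
    open ℚ.≤-Reasoning
    open +-*-Solver

  neg-cauchy : ∀ {x} → IsCauchy x → IsCauchy (λ n → ℚ.- x n)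
  neg-cauchy {x} cx ε 0<ε with cx ε 0<ε
  ... | N , hx = N , λ m n Nm Nn →
    subst (λ d → ℚ.∣ d ∣ ℚ.≤ ε)
      (solve 2 (λ a b → b :- a := (:- a) :- (:- b)) refl (x m) (x n))
      (hx n m Nn Nm)
    where open +-*-Solver

  ⊔-cauchy : ∀ {x y} → IsCauchy x → IsCauchy y → IsCauchy (λ n → x n ℚ.⊔ y n)
  ⊔-cauchy {x} {y} cx cy ε 0<ε with cx ε 0<ε | cy ε 0<ε
  ... | N , hx | M , hy = N ℕ.⊔ M , λ m n Nm Nn →
    p≤q+ε∧q≤p+ε⇒∣p-q∣≤ε (x m ℚ.⊔ y m) (x n ℚ.⊔ y n) (bound m n Nm Nn) (bound n m Nn Nm)
    where
    bound : ∀ m n → N ℕ.⊔ M ℕ.≤ m → N ℕ.⊔ M ℕ.≤ n →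
            x m ℚ.⊔ y m ℚ.≤ (x n ℚ.⊔ y n) ℚ.+ ε
    bound m n Nm Nn = ℚ.⊔-lub
      (ℚ.≤-trans
        (∣p-q∣≤ε⇒p≤q+ε (x m) (x n)
          (hx m n (ℕ.m⊔n≤o⇒m≤o N M Nm) (ℕ.m⊔n≤o⇒m≤o N M Nn)))
        (ℚ.+-monoˡ-≤ ε (ℚ.p≤p⊔q (x n) (y n))))
      (ℚ.≤-trans
        (∣p-q∣≤ε⇒p≤q+ε (y m) (y n)
          (hy m n (ℕ.m⊔n≤o⇒n≤o N M Nm) (ℕ.m⊔n≤o⇒n≤o N M Nn)))
        (ℚ.+-monoˡ-≤ ε (ℚ.p≤q⊔p (x n) (y n))))

  *-cauchy : ∀ {x} q .{{_ : ℚ.Positive q}} → IsCauchy x → IsCauchy (λ n → x n ℚ.* q)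
  *-cauchy {x} q cx ε 0<ε with cx (ε ℚ.* 1/q) 0<ε/q
    where
    instance
      q≢0 : ℚ.NonZero q
      q≢0 = ℚ.pos⇒nonZero q
    1/q : ℚ
    1/q = ℚ.1/ q
    0<ε/q : 0ℚ ℚ.< ε ℚ.* 1/q
    0<ε/q = subst (ℚ._< ε ℚ.* 1/q) (ℚ.*-zeroˡ 1/q)
              (ℚ.*-monoˡ-<-pos 1/q {{ℚ.1/pos⇒pos q}} 0<ε)
  ... | N , hx = N , λ m n Nm Nn → begin
    ℚ.∣ x m ℚ.* q ℚ.- x n ℚ.* q ∣
      ≡⟨ cong ℚ.∣_∣ (solve 3 (λ a b q → a :* q :- b :* q := (a :- b) :* q) refl (x m) (x n) q) ⟩
    ℚ.∣ (x m ℚ.- x n) ℚ.* q ∣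
      ≡⟨ ℚ.∣p*q∣≡∣p∣*∣q∣ (x m ℚ.- x n) q ⟩
    ℚ.∣ x m ℚ.- x n ∣ ℚ.* ℚ.∣ q ∣
      ≡⟨ cong (ℚ.∣ x m ℚ.- x n ∣ ℚ.*_) (ℚ.0≤p⇒∣p∣≡p (ℚ.<⇒≤ (ℚ.positive⁻¹ q))) ⟩
    ℚ.∣ x m ℚ.- x n ∣ ℚ.* q
      ≤⟨ ℚ.*-monoʳ-≤-nonNeg q {{ℚ.pos⇒nonNeg q}} (hx m n Nm Nn) ⟩
    (ε ℚ.* ℚ.1/ q) ℚ.* q
      ≡⟨ ℚ.*-assoc ε (ℚ.1/ q) q ⟩
    ε ℚ.* (ℚ.1/ q ℚ.* q)
      ≡⟨ cong (ε ℚ.*_) (ℚ.*-inverseˡ q) ⟩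
    ε ℚ.* 1ℚ
      ≡⟨ ℚ.*-identityʳ ε ⟩
    ε ∎
    where
    open ℚ.≤-Reasoning
    open +-*-Solver
    instance
      q≢0 : ℚ.NonZero q
      q≢0 = ℚ.pos⇒nonZero q

open CauchyProperties

0ℝ : ℝ
0ℝ = mkℝ (λ _ → 0ℚ) (λ ε 0<ε → 0 , λ _ _ _ _ → ℚ.<⇒≤ 0<ε)

_+ℝ_ : ℝ → ℝ → ℝ
mkℝ x cx +ℝ mkℝ y cy = mkℝ (λ n → x n ℚ.+ y n) (+-cauchy {x} {y} cx cy)

-ℝ_ : ℝ → ℝ
-ℝ mkℝ x cx = mkℝ (λ n → ℚ.- x n) (neg-cauchy {x} cx)

_-ℝ_ : ℝ → ℝ → ℝ
x -ℝ y = x +ℝ (-ℝ y)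

_⊔ℝ_ : ℝ → ℝ → ℝ
mkℝ x cx ⊔ℝ mkℝ y cy = mkℝ (λ n → x n ℚ.⊔ y n) (⊔-cauchy {x} {y} cx cy)

_÷ℝ_ : ℝ → (k : ℕ) .{{_ : NonZero k}} → ℝ
mkℝ x cx ÷ℝ k =
  mkℝ (λ n → x n ℚ.* (+ 1 ℚ./ k)) (*-cauchy {x} (+ 1 ℚ./ k) {{ℚ.normalize-pos 1 k}} cx)

∑ℝ : ∀ {m} → (Fin m → ℝ) → ℝ
∑ℝ = Vector.foldr _+ℝ_ 0ℝ

NonemptySubset : ℕ → Set
NonemptySubset n = ∃ λ (S : Subset n) → Nonempty S

nonempty⇒∣S∣≢0 : ∀ {n} {S : Subset n} → Nonempty S → NonZero ∣ S ∣
nonempty⇒∣S∣≢0 (_ , v∈S) = ℕ.>-nonZero (ℕ.≤-<-trans z≤n (x∈p⇒∣p-x∣<∣p∣ v∈S))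

⊤-nonempty : ∀ n .{{_ : NonZero n}} → Nonempty (⊤ {n})
⊤-nonempty (suc n) = zero , ∈⊤

subsets : ∀ n → List (Subset n)
subsets ℕ.zero  = [] ∷ []
subsets (suc n) = map (inside ∷_) (subsets n) ++ map (outside ∷_) (subsets n)

nonemptySubsets : ∀ n → List (NonemptySubset n)
nonemptySubsets n = mapMaybe (λ S → Maybe.map (S ,_) (dec⇒maybe (nonempty? S))) (subsets n)

WeightFunction : ℕ → Set
WeightFunction k = Fin (suc k) → ℝ

NonDecreasing : ∀ {k} → WeightFunction k → Set
NonDecreasing f = ∀ i j → toℕ j ≡ suc (toℕ i) → f i ≤ℝ f j

-- The triple (i , j , l) ranges over (i - 1 , i , i + 1) for 1 ≤ i ≤ k - 1.
Convex : ∀ {k} → WeightFunction k → Set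
Convex f = ∀ i j l → toℕ j ≡ suc (toℕ i) → toℕ l ≡ suc (toℕ j) →
           f j -ℝ f i ≤ℝ f l -ℝ f j

-- The vertex set is Fin n; the set of hyperedges is the image of the
-- injective family `edge`.
record Hypergraph : Set where
  field
    n m            : ℕ
    {{n≢0}}        : NonZero n
    {{m≢0}}        : NonZero m
    edge           : Fin m → Subset n
    edge-injective : Injective _≡_ _≡_ edge
    edge-nonempty  : ∀ e → Nonempty (edge e)
    weight         : ∀ e → WeightFunction ∣ edge e ∣
    weight-nonneg  : ∀ e i → 0ℝ ≤ℝ weight e i

  rank : ℕ
  rank = max 0 (tabulate (λ e → ∣ edge e ∣))

  F : Subset n → ℝ
  F S = ∑ℝ (λ e → weight e (fromℕ< (s≤s (∣p∩q∣≤∣p∣ (edge e) S))))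

  density : NonemptySubset n → ℝ
  density (S , S≢∅) = (F S ÷ℝ ∣ S ∣) {{nonempty⇒∣S∣≢0 S≢∅}}

  V : NonemptySubset n
  V = ⊤ , ⊤-nonempty n

  -- The initial value density V is itself one of the densities, so it
  -- does not affect the maximum.
  maxDensity : ℝ
  maxDensity = foldr _⊔ℝ_ (density V) (map density (nonemptySubsets n))

  loss : Subset n → Fin n → ℝ
  loss S v = F S -ℝ F (S - v)

  IsArgminLoss : Subset n → Fin n → Set
  IsArgminLoss S v = v ∈ S × (∀ u → u ∈ S → loss S v ≤ℝ loss S u)

  Improves : Subset n → NonemptySubset n → Set
  Improves S S′ = ∃ λ (S≢∅ : Nonempty S) → density S′ <ℝ density (S , S≢∅)

  -- Loop S S′ R: some execution of the while loop started from the
  -- values S and S′ of the two program variables returns R.  Ties are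
  -- broken arbitrarily, so this is a relation.
  data Loop : Subset n → NonemptySubset n → NonemptySubset n → Set where
    stop   : ∀ {S S′} → Empty S → Loop S S′ S′
    update : ∀ {S S′ R} v → IsArgminLoss S v →
             (imp : Improves (S - v) S′) →
             Loop (S - v) (S - v , proj₁ imp) R → Loop S S′ R
    keep   : ∀ {S S′ R} v → IsArgminLoss S v →
             ¬ Improves (S - v) S′ →
             Loop (S - v) S′ R → Loop S S′ R

  GDSH-Approx-Returns : NonemptySubset n → Set
  GDSH-Approx-Returns R = Loop ⊤ V R

rank≢0 : ∀ (H : Hypergraph) → NonZero (Hypergraph.rank H)
rank≢0 record { m = suc m ; edge = edge ; edge-nonempty = ne } =
  ℕ.>-nonZero (v≤max⁺ 0 (tabulate (λ e → ∣ edge e ∣))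
    (inj₂ (here (ℕ.>-nonZero⁻¹ ∣ edge zero ∣ {{nonempty⇒∣S∣≢0 (ne zero)}}))))

open Hypergraph public using (weight; rank; density; maxDensity; GDSH-Approx-Returns)

{-# OPTIONS --safe #-}
module Submission where

-- Let d be the density of the returned set and c = r d.  Every state S of the
-- loop has density at most d, and for the vertex v removed from S, averaging
-- over S gives |S| loss S v ≤ ∑_{u ∈ S} loss S u ≤ r F(S) ≤ |S| c: f_e is
-- nonnegative, so u ∈ e ∩ S costs at most f_e(|e ∩ S|) in the edge e.  By
-- convexity loss T v ≤ loss S v ≤ c whenever v ∈ T ⊆ S.  Hence a set T ⊆ V
-- loses at most c each time the loop removes one of its vertices, and since
-- F(∅) = 0 this adds up to F(T) ≤ |T| c.

open import Defs
open import Algebra.Bundles using (CommutativeMonoid; CommutativeRing)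
import Algebra.Properties.CommutativeMonoid.Mult
import Algebra.Properties.CommutativeMonoid.Sum
import Algebra.Properties.Semiring.Mult
open import Data.Bool using (true; false; if_then_else_)
open import Data.Bool.Properties using (∧-zeroʳ)
open import Data.Fin using (Fin; zero; suc; toℕ; fromℕ<)
open import Data.Fin.Properties using (toℕ-fromℕ<; fromℕ<-cong; toℕ-injective; toℕ<n)
open import Data.Fin.Subset
  using (Subset; inside; outside; ⊥; _∈_; _∉_; _⊆_; _∩_; _─_; _-_; ⁅_⁆; ∣_∣; Nonempty)
open import Data.Fin.Subset.Properties
  using (_∈?_; p─⊥≡p; p─q⊆p; x∈p∩q⁺; x∈p∩q⁻; x∈p∧x≢y⇒x∈p-y; p⊆q⇒∣p∣≤∣q∣; ⊆⊤;
         ∣p∩q∣≤∣p∣; Empty-unique; ∣⊥∣≡0; ∩-zeroʳ)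
open import Data.Integer as ℤ using (+_)
import Data.Integer.Properties as ℤ
open import Data.List.Extrema.Nat using (v≤max⁺)
open import Data.List.Properties using (foldr-preservesᵇ)
import Data.List.Relation.Unary.All as All
import Data.List.Relation.Unary.All.Properties as All
open import Data.List.Relation.Unary.Any.Properties using (tabulate⁺)
open import Data.Nat as ℕ using (ℕ; suc; NonZero; s≤s; z≤n)
import Data.Nat.Properties as ℕ
open import Data.Product using (_,_; proj₁; proj₂)
open import Data.Rational as ℚ using (ℚ; 0ℚ; 1ℚ; ½)
import Data.Rational.Properties as ℚ
open import Data.Rational.Solver using (module +-*-Solver)
open import Data.Rational.Unnormalised as ℚᵘ using (mkℚᵘ)
import Data.Rational.Unnormalised.Properties as ℚᵘ
open import Data.Sum using (inj₂)
open import Data.Vec using ([]; _∷_; lookup; here; there)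
open import Data.Vec.Properties using ([]=⇒lookup; lookup⇒[]=)
open import Function using (_∘_)
open import Level using (0ℓ)
open import Relation.Binary.Bundles using (Preorder)
import Relation.Binary.Reasoning.Preorder
open import Relation.Binary.PropositionalEquality
  using (_≡_; refl; sym; trans; cong; cong₂; subst; module ≡-Reasoning)
open import Relation.Nullary using (¬_; yes; no; contradiction)
open import Relation.Nullary.Decidable using (decidable-stable)
open CauchyProperties

-- Algebra of real numbers up to pointwise equality.

infix 4 _≐_

-- Finer than _≈ℝ_, but all algebraic laws used below hold up to it.
_≐_ : ℝ → ℝ → Set
x ≐ y = ∀ n → seq x n ≡ seq y n

+ℝ-0ℝ-commutativeMonoid : CommutativeMonoid 0ℓ 0ℓ
+ℝ-0ℝ-commutativeMonoid = record
  { Carrier = ℝ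
  ; _≈_ = _≐_
  ; _∙_ = _+ℝ_
  ; ε = 0ℝ
  ; isCommutativeMonoid = record
    { isMonoid = record
      { isSemigroup = record
        { isMagma = record
          { isEquivalence = record
            { refl = λ _ → refl
            ; sym = λ x≐y n → sym (x≐y n)
            ; trans = λ x≐y y≐z n → trans (x≐y n) (y≐z n)
            }
          ; ∙-cong = λ x≐y u≐v n → cong₂ ℚ._+_ (x≐y n) (u≐v n)
          }
        ; assoc = λ x y z n → ℚ.+-assoc (seq x n) (seq y n) (seq z n)
        }
      ; identity = (λ x n → ℚ.+-identityˡ (seq x n)) , (λ x n → ℚ.+-identityʳ (seq x n))
      }
    ; comm = λ x y n → ℚ.+-comm (seq x n) (seq y n)
    }
  }

module +ℝ = CommutativeMonoid +ℝ-0ℝ-commutativeMonoid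
open Algebra.Properties.CommutativeMonoid.Sum +ℝ-0ℝ-commutativeMonoid
  using (sum-cong-≋; ∑-distrib-+; ∑-comm; sum-replicate; sum-replicate-zero)
open Algebra.Properties.CommutativeMonoid.Mult +ℝ-0ℝ-commutativeMonoid
  using (×-assocˡ) renaming (_×_ to _·_)
open Algebra.Properties.Semiring.Mult (CommutativeRing.semiring ℚ.+-*-commutativeRing)
  using (×-comm-*) renaming (_×_ to _·ℚ_)
open Algebra.Properties.CommutativeMonoid.Mult ℚ.+-0-commutativeMonoid
  using () renaming (×-distrib-+ to ·ℚ-distrib-+)

-- Natural multiples as inverse to division by a natural number.

k·1/d≡k/d : ∀ k d .{{_ : NonZero d}} → k ·ℚ (+ 1 ℚ./ d) ≡ + k ℚ./ d
k·1/d≡k/d ℕ.zero  d = sym (ℚ.0/n≡0 d)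
k·1/d≡k/d (suc k) d@(suc d-1) = begin
  (+ 1 ℚ./ d) ℚ.+ k ·ℚ (+ 1 ℚ./ d)  ≡⟨ cong ((+ 1 ℚ./ d) ℚ.+_) (k·1/d≡k/d k d) ⟩
  -- Reduction to lowest terms hides the common denominator `d`, so the fractions are added as
  -- unnormalised rationals.
  (+ 1 ℚ./ d) ℚ.+ (+ k ℚ./ d)       ≡⟨ ℚ.toℚᵘ-injective (begin-equality
    ℚ.toℚᵘ ((+ 1 ℚ./ d) ℚ.+ (+ k ℚ./ d))
      ≃⟨ ℚ.toℚᵘ-homo-+ (+ 1 ℚ./ d) (+ k ℚ./ d) ⟩
    ℚ.toℚᵘ (+ 1 ℚ./ d) ℚᵘ.+ ℚ.toℚᵘ (+ k ℚ./ d)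
      ≃⟨ ℚᵘ.+-cong (ℚ.toℚᵘ-fromℚᵘ (mkℚᵘ (+ 1) d-1)) (ℚ.toℚᵘ-fromℚᵘ (mkℚᵘ (+ k) d-1)) ⟩
    mkℚᵘ (+ 1) d-1 ℚᵘ.+ mkℚᵘ (+ k) d-1
      ≃⟨ ℚᵘ.*≡* numerators ⟩
    mkℚᵘ (+ suc k) d-1
      ≃⟨ ℚ.toℚᵘ-fromℚᵘ (mkℚᵘ (+ suc k) d-1) ⟨
    ℚ.toℚᵘ (+ suc k ℚ./ d) ∎ℚᵘ) ⟩
  + suc k ℚ./ d  ∎
  where
  open ≡-Reasoning
  open ℚᵘ.≤-Reasoning using (begin-equality_; step-≃-⟩; step-≃-⟨) renaming (_∎ to _∎ℚᵘ)
  numerators : (+ 1 ℤ.* + d ℤ.+ + k ℤ.* + d) ℤ.* + d ≡ + suc k ℤ.* (+ d ℤ.* + d)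
  numerators = trans (cong (ℤ._* + d) (sym (ℤ.*-distribʳ-+ (+ d) (+ 1) (+ k))))
                     (ℤ.*-assoc (+ suc k) (+ d) (+ d))

k·1/k≡1 : ∀ k .{{_ : NonZero k}} → k ·ℚ (+ 1 ℚ./ k) ≡ 1ℚ
k·1/k≡1 k@(suc k-1) = trans (k·1/d≡k/d k k)
  (ℚ.fromℚᵘ-cong {mkℚᵘ (+ k) k-1} {mkℚᵘ (+ 1) 0} (ℚᵘ.*≡* (ℤ.*-comm (+ k) (+ 1))))

seq-· : ∀ k x n → seq (k · x) n ≡ k ·ℚ seq x n
seq-· ℕ.zero  x n = refl
seq-· (suc k) x n = cong (seq x n ℚ.+_) (seq-· k x n)

-- Stated for any z with the sequence of x ÷ℝ k: terms k · (x ÷ℝ k) would make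
-- the conversion checker unfold the proof of Cauchyness inside x ÷ℝ k.
k·z≐x : ∀ k .{{_ : NonZero k}} {x z} → (∀ n → seq z n ≡ seq x n ℚ.* (+ 1 ℚ./ k)) → k · z ≐ x
k·z≐x k {x} {z} z≐x÷k n = begin
  seq (k · z) n                   ≡⟨ seq-· k z n ⟩
  k ·ℚ seq z n                    ≡⟨ cong (k ·ℚ_) (z≐x÷k n) ⟩
  k ·ℚ (seq x n ℚ.* (+ 1 ℚ./ k))  ≡⟨ ×-comm-* k (seq x n) (+ 1 ℚ./ k) ⟨
  seq x n ℚ.* k ·ℚ (+ 1 ℚ./ k)    ≡⟨ cong (seq x n ℚ.*_) (k·1/k≡1 k) ⟩
  seq x n ℚ.* 1ℚ                  ≡⟨ ℚ.*-identityʳ (seq x n) ⟩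
  seq x n                         ∎
  where open ≡-Reasoning

·ℚ-monoʳ-< : ∀ k .{{_ : NonZero k}} {p q} → p ℚ.< q → k ·ℚ p ℚ.< k ·ℚ q
·ℚ-monoʳ-< (suc ℕ.zero)    p<q = ℚ.+-mono-<-≤ p<q ℚ.≤-refl
·ℚ-monoʳ-< (suc k@(suc _)) p<q = ℚ.+-mono-< p<q (·ℚ-monoʳ-< k p<q)

·ℚ-cancelˡ-≤ : ∀ k .{{_ : NonZero k}} {p q} → k ·ℚ p ℚ.≤ k ·ℚ q → p ℚ.≤ q
·ℚ-cancelˡ-≤ k kp≤kq = ℚ.≮⇒≥ λ q<p →
  ℚ.<-irrefl refl (ℚ.<-≤-trans (·ℚ-monoʳ-< k q<p) kp≤kq)

-- The order on the real numbers.

≤ℝ-reflexive : ∀ {x y} → x ≐ y → x ≤ℝ y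
≤ℝ-reflexive {x} {y} x≐y ε 0<ε = 0 , λ n _ → begin
  seq x n         ≡⟨ x≐y n ⟩
  seq y n         ≡⟨ ℚ.+-identityʳ (seq y n) ⟨
  seq y n ℚ.+ 0ℚ  ≤⟨ ℚ.+-monoʳ-≤ (seq y n) (ℚ.<⇒≤ 0<ε) ⟩
  seq y n ℚ.+ ε   ∎
  where open ℚ.≤-Reasoning

≤ℝ-trans : ∀ {x y z} → x ≤ℝ y → y ≤ℝ z → x ≤ℝ z
≤ℝ-trans {x} {y} {z} x≤y y≤z ε 0<ε with x≤y (½ ℚ.* ε) (0<½*ε 0<ε) | y≤z (½ ℚ.* ε) (0<½*ε 0<ε)
... | N , x≤y+ | M , y≤z+ = N ℕ.⊔ M , λ n N⊔M≤n → begin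
  seq x n                                  ≤⟨ x≤y+ n (ℕ.m⊔n≤o⇒m≤o N M N⊔M≤n) ⟩
  seq y n ℚ.+ ½ ℚ.* ε                      ≤⟨ ℚ.+-monoˡ-≤ (½ ℚ.* ε)
                                                (y≤z+ n (ℕ.m⊔n≤o⇒n≤o N M N⊔M≤n)) ⟩
  seq z n ℚ.+ ½ ℚ.* ε ℚ.+ ½ ℚ.* ε          ≡⟨ ℚ.+-assoc (seq z n) (½ ℚ.* ε) (½ ℚ.* ε) ⟩
  seq z n ℚ.+ (½ ℚ.* ε ℚ.+ ½ ℚ.* ε)        ≡⟨ cong (seq z n ℚ.+_) (½*ε+½*ε≡ε ε) ⟩
  seq z n ℚ.+ ε                            ∎
  where open ℚ.≤-Reasoning

-- The underlying equality is pointwise, so the `≈` steps of the resulting reasoning are exact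
-- identities and cost no tolerance.
≤ℝ-preorder : Preorder 0ℓ 0ℓ 0ℓ
≤ℝ-preorder = record
  { _≈_ = _≐_
  ; _≲_ = _≤ℝ_
  ; isPreorder = record
    { isEquivalence = +ℝ.isEquivalence
    ; reflexive = λ {x} {y} → ≤ℝ-reflexive {x} {y}
    ; trans = λ {x} {y} {z} → ≤ℝ-trans {x} {y} {z}
    }
  }

≤ℝ-refl : ∀ x → x ≤ℝ x
≤ℝ-refl x = ≤ℝ-reflexive {x} {x} (λ _ → refl)

<ℝ⇒≤ℝ : ∀ {x y} → x <ℝ y → x ≤ℝ y
<ℝ⇒≤ℝ {x} {y} (γ , 0<γ , N , x+γ≤y) ε 0<ε = N , λ n N≤n → begin
  seq x n         ≡⟨ ℚ.+-identityʳ (seq x n) ⟨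
  seq x n ℚ.+ 0ℚ  ≤⟨ ℚ.+-monoʳ-≤ (seq x n) (ℚ.<⇒≤ 0<γ) ⟩
  seq x n ℚ.+ γ   ≤⟨ x+γ≤y n N≤n ⟩
  seq y n         ≡⟨ ℚ.+-identityʳ (seq y n) ⟨
  seq y n ℚ.+ 0ℚ  ≤⟨ ℚ.+-monoʳ-≤ (seq y n) (ℚ.<⇒≤ 0<ε) ⟩
  seq y n ℚ.+ ε   ∎
  where open ℚ.≤-Reasoning

module ≤ℝ-Reasoning = Relation.Binary.Reasoning.Preorder ≤ℝ-preorder

+ℝ-mono-≤ : ∀ {x y u v} → x ≤ℝ y → u ≤ℝ v → x +ℝ u ≤ℝ y +ℝ v
+ℝ-mono-≤ {x} {y} {u} {v} x≤y u≤v ε 0<ε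
  with x≤y (½ ℚ.* ε) (0<½*ε 0<ε) | u≤v (½ ℚ.* ε) (0<½*ε 0<ε)
... | N , x≤y+ | M , u≤v+ = N ℕ.⊔ M , λ n N⊔M≤n → begin
  seq x n ℚ.+ seq u n
    ≤⟨ ℚ.+-mono-≤ (x≤y+ n (ℕ.m⊔n≤o⇒m≤o N M N⊔M≤n)) (u≤v+ n (ℕ.m⊔n≤o⇒n≤o N M N⊔M≤n)) ⟩
  (seq y n ℚ.+ ½ ℚ.* ε) ℚ.+ (seq v n ℚ.+ ½ ℚ.* ε)
    ≡⟨ solve 3 (λ a b h → (a :+ h) :+ (b :+ h) := (a :+ b) :+ (h :+ h))
         refl (seq y n) (seq v n) (½ ℚ.* ε) ⟩
  (seq y n ℚ.+ seq v n) ℚ.+ (½ ℚ.* ε ℚ.+ ½ ℚ.* ε)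
    ≡⟨ cong ((seq y n ℚ.+ seq v n) ℚ.+_) (½*ε+½*ε≡ε ε) ⟩
  (seq y n ℚ.+ seq v n) ℚ.+ ε ∎
  where
  open ℚ.≤-Reasoning
  open +-*-Solver

neg-antimono-≤ℝ : ∀ {x y} → x ≤ℝ y → -ℝ y ≤ℝ -ℝ x
neg-antimono-≤ℝ {x} {y} x≤y ε 0<ε with x≤y ε 0<ε
... | N , x≤y+ = N , λ n N≤n → begin
  ℚ.- seq y n                    ≡⟨ solve 2 (λ b e → :- b := :- (b :+ e) :+ e) refl (seq y n) ε ⟩
  ℚ.- (seq y n ℚ.+ ε) ℚ.+ ε      ≤⟨ ℚ.+-monoˡ-≤ ε (ℚ.neg-antimono-≤ (x≤y+ n N≤n)) ⟩
  ℚ.- seq x n ℚ.+ ε              ∎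
  where
  open ℚ.≤-Reasoning
  open +-*-Solver

⊔ℝ-lub : ∀ {x y z} → x ≤ℝ z → y ≤ℝ z → x ⊔ℝ y ≤ℝ z
⊔ℝ-lub x≤z y≤z ε 0<ε with x≤z ε 0<ε | y≤z ε 0<ε
... | N , x≤z+ | M , y≤z+ = N ℕ.⊔ M , λ n N⊔M≤n →
  ℚ.⊔-lub (x≤z+ n (ℕ.m⊔n≤o⇒m≤o N M N⊔M≤n)) (y≤z+ n (ℕ.m⊔n≤o⇒n≤o N M N⊔M≤n))

-- The multiples are compared with tolerance `k ·ℚ ε`, which becomes `ε` once the positive factor
-- `k` is cancelled in the rationals.
·-cancelˡ-≤ : ∀ k .{{_ : NonZero k}} {x y} → k · x ≤ℝ k · y → x ≤ℝ y
·-cancelˡ-≤ k {x} {y} kx≤ky ε 0<ε with kx≤ky (k ·ℚ ε) 0<kε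
  where
  0<kε : 0ℚ ℚ.< k ·ℚ ε
  0<kε = subst (ℚ._< k ·ℚ ε) (trans (sym (×-comm-* k 0ℚ 0ℚ)) (ℚ.*-zeroˡ (k ·ℚ 0ℚ)))
               (·ℚ-monoʳ-< k 0<ε)
... | N , kx≤ky+ = N , λ n N≤n → ·ℚ-cancelˡ-≤ k (begin
  k ·ℚ seq x n                ≡⟨ seq-· k x n ⟨
  seq (k · x) n               ≤⟨ kx≤ky+ n N≤n ⟩
  seq (k · y) n ℚ.+ k ·ℚ ε    ≡⟨ cong (ℚ._+ k ·ℚ ε) (seq-· k y n) ⟩
  k ·ℚ seq y n ℚ.+ k ·ℚ ε     ≡⟨ ·ℚ-distrib-+ (seq y n) ε k ⟨
  k ·ℚ (seq y n ℚ.+ ε)        ∎)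
  where open ℚ.≤-Reasoning

-- Cauchyness makes the order stable: a failure of x ≤ y + ε at a late
-- index n would persist, with gap ε / 2, at all later indices.
≮ℝ⇒≥ℝ : ∀ {x y} → ¬ (y <ℝ x) → x ≤ℝ y
≮ℝ⇒≥ℝ {x} {y} y≮x ε 0<ε = N ℕ.⊔ M , λ n N⊔M≤n →
  decidable-stable (seq x n ℚ.≤? seq y n ℚ.+ ε) λ x≰y+ε →
  y≮x (δ , 0<½*ε 0<ε , N ℕ.⊔ M , λ m N⊔M≤m → begin
    seq y m ℚ.+ δ
      ≤⟨ ℚ.+-monoˡ-≤ δ (∣p-q∣≤ε⇒p≤q+ε (seq y m) (seq y n) (proj₂ cy m n
           (ℕ.m⊔n≤o⇒n≤o N M N⊔M≤m) (ℕ.m⊔n≤o⇒n≤o N M N⊔M≤n))) ⟩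
    seq y n ℚ.+ η ℚ.+ δ
      ≡⟨ cong (seq y n ℚ.+ η ℚ.+_) (½*ε+½*ε≡ε δ) ⟨
    seq y n ℚ.+ η ℚ.+ (η ℚ.+ η)
      ≡⟨ solve 2 (λ b h → b :+ h :+ (h :+ h) := b :+ ((h :+ h) :+ (h :+ h)) :- h)
           refl (seq y n) η ⟩
    seq y n ℚ.+ ((η ℚ.+ η) ℚ.+ (η ℚ.+ η)) ℚ.- η
      ≡⟨ cong (λ d → seq y n ℚ.+ (d ℚ.+ d) ℚ.- η) (½*ε+½*ε≡ε δ) ⟩
    seq y n ℚ.+ (δ ℚ.+ δ) ℚ.- η
      ≡⟨ cong (λ d → seq y n ℚ.+ d ℚ.- η) (½*ε+½*ε≡ε ε) ⟩
    seq y n ℚ.+ ε ℚ.- η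
      ≤⟨ ℚ.+-monoˡ-≤ (ℚ.- η) (ℚ.<⇒≤ (ℚ.≰⇒> x≰y+ε)) ⟩
    seq x n ℚ.- η
      ≤⟨ ℚ.+-monoˡ-≤ (ℚ.- η) (∣p-q∣≤ε⇒p≤q+ε (seq x n) (seq x m) (proj₂ cx n m
           (ℕ.m⊔n≤o⇒m≤o N M N⊔M≤n) (ℕ.m⊔n≤o⇒m≤o N M N⊔M≤m))) ⟩
    seq x m ℚ.+ η ℚ.- η
      ≡⟨ solve 2 (λ a h → a :+ h :- h := a) refl (seq x m) η ⟩
    seq x m ∎)
  where
  open ℚ.≤-Reasoning
  open +-*-Solver
  δ = ½ ℚ.* ε
  -- Passing from index `n` to index `m` costs `η` in each of the two sequences; as ε = δ + 2η, the
  -- gap `δ` remains.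
  η = ½ ℚ.* δ
  cx = cauchy x η (0<½*ε (0<½*ε 0<ε))
  cy = cauchy y η (0<½*ε (0<½*ε 0<ε))
  N = proj₁ cx
  M = proj₁ cy

-- Inequalities for differences, multiples and quotients.

x-y≤x : ∀ {x y} → 0ℝ ≤ℝ y → x -ℝ y ≤ℝ x
x-y≤x {x} {y} 0≤y = begin
  x -ℝ y     ≲⟨ +ℝ-mono-≤ {x} {x} { -ℝ y} { -ℝ 0ℝ} (≤ℝ-refl x) (neg-antimono-≤ℝ {0ℝ} {y} 0≤y) ⟩
  x -ℝ 0ℝ    ≈⟨ (λ n → ℚ.+-identityʳ (seq x n)) ⟩
  x          ∎
  where open ≤ℝ-Reasoning

x-y≤z⇒x≤z+y : ∀ {x y z} → x -ℝ y ≤ℝ z → x ≤ℝ z +ℝ y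
x-y≤z⇒x≤z+y {x} {y} {z} x-y≤z = begin
  x              ≈⟨ (λ n → solve 2 (λ a b → a := (a :- b) :+ b) refl (seq x n) (seq y n)) ⟩
  (x -ℝ y) +ℝ y  ≲⟨ +ℝ-mono-≤ {x -ℝ y} {z} {y} {y} x-y≤z (≤ℝ-refl y) ⟩
  z +ℝ y         ∎
  where
  open ≤ℝ-Reasoning
  open +-*-Solver

·-monoʳ-≤ : ∀ k {x y} → x ≤ℝ y → k · x ≤ℝ k · y
·-monoʳ-≤ ℕ.zero          x≤y = ≤ℝ-refl 0ℝ
·-monoʳ-≤ (suc k) {x} {y} x≤y = +ℝ-mono-≤ {x} {y} {k · x} {k · y} x≤y (·-monoʳ-≤ k {x} {y} x≤y)

·-monoˡ-≤ : ∀ {j k} x → 0ℝ ≤ℝ x → j ℕ.≤ k → j · x ≤ℝ k · x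
·-monoˡ-≤ {k = ℕ.zero} x 0≤x z≤n = ≤ℝ-refl 0ℝ
·-monoˡ-≤ {k = suc k}  x 0≤x z≤n = begin
  0ℝ          ≈⟨ +ℝ.identityˡ 0ℝ ⟨
  0ℝ +ℝ 0ℝ    ≲⟨ +ℝ-mono-≤ {0ℝ} {x} {0ℝ} {k · x} 0≤x (·-monoˡ-≤ {0} {k} x 0≤x z≤n) ⟩
  x +ℝ k · x  ∎
  where open ≤ℝ-Reasoning
·-monoˡ-≤ {suc j} {suc k} x 0≤x (s≤s j≤k) =
  +ℝ-mono-≤ {x} {x} {j · x} {k · x} (≤ℝ-refl x) (·-monoˡ-≤ {j} {k} x 0≤x j≤k)

x÷k≤y⇒x≤k·y : ∀ k .{{_ : NonZero k}} {x y} → x ÷ℝ k ≤ℝ y → x ≤ℝ k · y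
x÷k≤y⇒x≤k·y k {x} {y} = go (x ÷ℝ k) (λ _ → refl)
  where
  open ≤ℝ-Reasoning
  -- The quotient is abstracted to a `z` known only through its sequence, which keeps its proof of
  -- Cauchyness folded.
  go : ∀ z → (∀ n → seq z n ≡ seq x n ℚ.* (+ 1 ℚ./ k)) → z ≤ℝ y → x ≤ℝ k · y
  go z z≐x÷k z≤y = begin
    x      ≈⟨ k·z≐x k {x} {z} z≐x÷k ⟨
    k · z  ≲⟨ ·-monoʳ-≤ k {z} {y} z≤y ⟩
    k · y  ∎

x≤k·y⇒x÷k≤y : ∀ k .{{_ : NonZero k}} {x y} → x ≤ℝ k · y → x ÷ℝ k ≤ℝ y
x≤k·y⇒x÷k≤y k {x} {y} = go (x ÷ℝ k) (λ _ → refl)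
  where
  open ≤ℝ-Reasoning
  go : ∀ z → (∀ n → seq z n ≡ seq x n ℚ.* (+ 1 ℚ./ k)) → x ≤ℝ k · y → z ≤ℝ y
  go z z≐x÷k x≤k·y = ·-cancelˡ-≤ k {z} {y} (begin
    k · z  ≈⟨ k·z≐x k {x} {z} z≐x÷k ⟩
    x      ≲⟨ x≤k·y ⟩
    k · y  ∎)

·-leftComm : ∀ j k x → j · (k · x) ≐ k · (j · x)
·-leftComm j k x n = begin
  seq (j · (k · x)) n    ≡⟨ ×-assocˡ x j k n ⟩
  seq ((j ℕ.* k) · x) n  ≡⟨ cong (λ l → seq (l · x) n) (ℕ.*-comm j k) ⟩
  seq ((k ℕ.* j) · x) n  ≡⟨ ×-assocˡ x k j n ⟨
  seq (k · (j · x)) n    ∎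
  where open ≡-Reasoning

-- Finite sums of real numbers.

∑ℝ-mono-≤ : ∀ {m} {f g : Fin m → ℝ} → (∀ i → f i ≤ℝ g i) → ∑ℝ f ≤ℝ ∑ℝ g
∑ℝ-mono-≤ {ℕ.zero}        f≤g = ≤ℝ-refl 0ℝ
∑ℝ-mono-≤ {suc m} {f} {g} f≤g =
  +ℝ-mono-≤ {f zero} {g zero} {∑ℝ (f ∘ suc)} {∑ℝ (g ∘ suc)}
    (f≤g zero) (∑ℝ-mono-≤ {m} {f ∘ suc} {g ∘ suc} (f≤g ∘ suc))

∑ℝ-distrib-neg : ∀ {m} (f : Fin m → ℝ) → -ℝ ∑ℝ f ≐ ∑ℝ (λ i → -ℝ f i)
∑ℝ-distrib-neg {ℕ.zero} f n = refl
∑ℝ-distrib-neg {suc m}  f n =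
  trans (ℚ.neg-distrib-+ (seq (f zero) n) (seq (∑ℝ (f ∘ suc)) n))
        (cong (ℚ.- seq (f zero) n ℚ.+_) (∑ℝ-distrib-neg (f ∘ suc) n))

∑ℝ-distrib-- : ∀ {m} (f g : Fin m → ℝ) → ∑ℝ f -ℝ ∑ℝ g ≐ ∑ℝ (λ i → f i -ℝ g i)
∑ℝ-distrib-- f g n = trans (cong (seq (∑ℝ f) n ℚ.+_) (∑ℝ-distrib-neg g n))
                           (sym (∑-distrib-+ f (λ i → -ℝ g i) n))

-- A multiple is a sum of `k` equal terms, so this is an exchange of two summations.
∑ℝ-distrib-· : ∀ k {m} (f : Fin m → ℝ) → ∑ℝ (λ i → k · f i) ≐ k · ∑ℝ f
∑ℝ-distrib-· k {m} f n = begin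
  seq (∑ℝ (λ i → k · f i)) n             ≡⟨ sum-cong-≋ (λ i n → sym (sum-replicate k {f i} n)) n ⟩
  seq (∑ℝ (λ i → ∑ℝ {k} (λ _ → f i))) n  ≡⟨ ∑-comm {m} {k} (λ i _ → f i) n ⟩
  seq (∑ℝ {k} (λ _ → ∑ℝ f)) n            ≡⟨ sum-replicate k n ⟩
  seq (k · ∑ℝ f) n                       ∎
  where open ≡-Reasoning

-- Lets sums over a subset be written over all indices, so that summations over vertices and edges
-- can be exchanged.
∑ℝ-indicator : ∀ {n} (p : Subset n) x → ∑ℝ (λ i → if lookup p i then x else 0ℝ) ≐ ∣ p ∣ · x
∑ℝ-indicator []            x n = refl
∑ℝ-indicator (inside  ∷ p) x n = cong (seq x n ℚ.+_) (∑ℝ-indicator p x n)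
∑ℝ-indicator (outside ∷ p) x n = trans (ℚ.+-identityˡ _) (∑ℝ-indicator p x n)

-- Removing one element from a finite subset.

x∈p⇒1+∣p-x∣≡∣p∣ : ∀ {n} {x : Fin n} {p : Subset n} → x ∈ p → suc ∣ p - x ∣ ≡ ∣ p ∣
x∈p⇒1+∣p-x∣≡∣p∣ {p = inside  ∷ p} here        = cong (suc ∘ ∣_∣) (p─⊥≡p p)
x∈p⇒1+∣p-x∣≡∣p∣ {p = inside  ∷ p} (there x∈p) = cong suc (x∈p⇒1+∣p-x∣≡∣p∣ x∈p)
x∈p⇒1+∣p-x∣≡∣p∣ {p = outside ∷ p} (there x∈p) = x∈p⇒1+∣p-x∣≡∣p∣ x∈p

x∉p⇒p-x≡p : ∀ {n} {x : Fin n} {p : Subset n} → x ∉ p → p - x ≡ p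
x∉p⇒p-x≡p {x = zero}  {inside  ∷ p} x∉p = contradiction here x∉p
x∉p⇒p-x≡p {x = zero}  {outside ∷ p} x∉p = cong (outside ∷_) (p─⊥≡p p)
x∉p⇒p-x≡p {x = suc x} {s ∷ p}       x∉p = cong (s ∷_) (x∉p⇒p-x≡p (x∉p ∘ there))

x∉p-x : ∀ {n} {x : Fin n} (p : Subset n) → x ∉ p - x
x∉p-x {x = zero}  (_ ∷ p) ()
x∉p-x {x = suc x} (_ ∷ p) (there x∈p-x) = x∉p-x p x∈p-x

-- Turns the removal of a vertex from S into its removal from e ∩ S, whose size is the argument of
-- the edge weight.
p∩[q─r]≡p∩q─r : ∀ {n} (p q r : Subset n) → p ∩ (q ─ r) ≡ p ∩ q ─ r
p∩[q─r]≡p∩q─r []      []      []            = refl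
p∩[q─r]≡p∩q─r (s ∷ p) (t ∷ q) (inside  ∷ r) = cong₂ _∷_ (∧-zeroʳ s) (p∩[q─r]≡p∩q─r p q r)
p∩[q─r]≡p∩q─r (s ∷ p) (t ∷ q) (outside ∷ r) = cong (_ ∷_) (p∩[q─r]≡p∩q─r p q r)

-- Convexity compares neighbouring increments only; induction on the distance `d` between the two
-- increments chains these comparisons.
convex⇒increments-mono : ∀ {k} (f : WeightFunction k) → Convex f →
  ∀ d i j i′ j′ → toℕ j ≡ suc (toℕ i) → toℕ j′ ≡ suc (toℕ i′) → toℕ j′ ≡ d ℕ.+ toℕ j →
  f j -ℝ f i ≤ℝ f j′ -ℝ f i′
convex⇒increments-mono f f-convex ℕ.zero i j i′ j′ j≡1+i j′≡1+i′ j′≡j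
  with refl ← toℕ-injective j′≡j
     | refl ← toℕ-injective (ℕ.suc-injective (trans (sym j≡1+i) (trans (sym j′≡j) j′≡1+i′)))
  = ≤ℝ-refl (f j -ℝ f i)
convex⇒increments-mono {k} f f-convex (suc d) i j i′ j′ j≡1+i j′≡1+i′ j′≡1+d+j = begin
  f j -ℝ f i    ≲⟨ convex⇒increments-mono f f-convex d i j h i′ j≡1+i i′≡1+h i′≡d+j ⟩
  f i′ -ℝ f h   ≲⟨ f-convex h i′ j′ i′≡1+h j′≡1+i′ ⟩
  f j′ -ℝ f i′  ∎
  where
  open ≤ℝ-Reasoning
  i′≡d+j : toℕ i′ ≡ d ℕ.+ toℕ j
  i′≡d+j = ℕ.suc-injective (trans (sym j′≡1+i′) j′≡1+d+j)
  i′≡1+d+i : toℕ i′ ≡ suc (d ℕ.+ toℕ i)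
  i′≡1+d+i = trans i′≡d+j (trans (cong (d ℕ.+_) j≡1+i) (ℕ.+-suc d (toℕ i)))
  d+i<1+k : d ℕ.+ toℕ i ℕ.< suc k
  d+i<1+k = ℕ.<-trans (ℕ.≤-reflexive (sym i′≡1+d+i)) (toℕ<n i′)
  h : Fin (suc k)
  -- The predecessor of `i′`, so that the increment from `h` to `i′` lies one step to the left of
  -- the target.
  h = fromℕ< d+i<1+k
  i′≡1+h : toℕ i′ ≡ suc (toℕ h)
  i′≡1+h = trans i′≡1+d+i (cong suc (sym (toℕ-fromℕ< d+i<1+k)))

-- Marginal weights of edges and losses of vertices.

module Peeling (H : Hypergraph)
  (convex : ∀ e → Convex (weight H e))
  (f0≈0 : ∀ e → weight H e zero ≈ℝ 0ℝ)
  where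

  open Hypergraph H
    using (n; m; edge; weight-nonneg; F; loss; IsArgminLoss; Loop; stop; update; keep)

  index : ∀ e → Subset n → Fin (suc ∣ edge e ∣)
  index e S = fromℕ< (s≤s (∣p∩q∣≤∣p∣ (edge e) S))

  toℕ-index : ∀ e S → toℕ (index e S) ≡ ∣ edge e ∩ S ∣
  toℕ-index e S = toℕ-fromℕ< (s≤s (∣p∩q∣≤∣p∣ (edge e) S))

  edgeWeight : Fin m → Subset n → ℝ
  edgeWeight e S = weight H e (index e S)

  -- Removing `v` leaves e ∩ S unchanged, so both weights are read at the same index.
  marginal-outside : ∀ e S v → v ∉ edge e ∩ S →
                     edgeWeight e S -ℝ edgeWeight e (S - v) ≐ 0ℝ
  marginal-outside e S v v∉e∩S k = trans
    (cong (λ i → seq (edgeWeight e S -ℝ weight H e i) k) same-index)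
    (ℚ.+-inverseʳ (seq (edgeWeight e S) k))
    where
    same-index : index e (S - v) ≡ index e S
    same-index = fromℕ<-cong _ _
      (cong ∣_∣ (trans (p∩[q─r]≡p∩q─r (edge e) S ⁅ v ⁆) (x∉p⇒p-x≡p v∉e∩S))) _ _

  -- If v ∈ e, both sides are unit increments of the same convex function, and the one for `S` lies
  -- at least as far to the right because e ∩ T ⊆ e ∩ S. If v ∉ e, both sides vanish.
  marginal-mono : ∀ e {T S v} → T ⊆ S → v ∈ T →
    edgeWeight e T -ℝ edgeWeight e (T - v) ≤ℝ edgeWeight e S -ℝ edgeWeight e (S - v)
  marginal-mono e {T} {S} {v} T⊆S v∈T with v ∈? edge e
  ... | yes v∈e = convex⇒increments-mono (weight H e) (convex e) (∣ edge e ∩ S ∣ ℕ.∸ ∣ edge e ∩ T ∣)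
    (index e (T - v)) (index e T) (index e (S - v)) (index e S)
    (index-pred T v∈T) (index-pred S (T⊆S v∈T)) (begin
      toℕ (index e S)
        ≡⟨ toℕ-index e S ⟩
      ∣ edge e ∩ S ∣
        ≡⟨ ℕ.m∸n+n≡m (p⊆q⇒∣p∣≤∣q∣ (λ x∈e∩T → x∈p∩q⁺
             (proj₁ (x∈p∩q⁻ (edge e) T x∈e∩T) , T⊆S (proj₂ (x∈p∩q⁻ (edge e) T x∈e∩T))))) ⟨
      ∣ edge e ∩ S ∣ ℕ.∸ ∣ edge e ∩ T ∣ ℕ.+ ∣ edge e ∩ T ∣
        ≡⟨ cong (∣ edge e ∩ S ∣ ℕ.∸ ∣ edge e ∩ T ∣ ℕ.+_) (toℕ-index e T) ⟨
      ∣ edge e ∩ S ∣ ℕ.∸ ∣ edge e ∩ T ∣ ℕ.+ toℕ (index e T) ∎)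
    where
    open ≡-Reasoning
    index-pred : ∀ U → v ∈ U → toℕ (index e U) ≡ suc (toℕ (index e (U - v)))
    index-pred U v∈U = begin
      toℕ (index e U)              ≡⟨ toℕ-index e U ⟩
      ∣ edge e ∩ U ∣               ≡⟨ x∈p⇒1+∣p-x∣≡∣p∣ (x∈p∩q⁺ (v∈e , v∈U)) ⟨
      suc ∣ edge e ∩ U - v ∣       ≡⟨ cong (suc ∘ ∣_∣) (p∩[q─r]≡p∩q─r (edge e) U ⁅ v ⁆) ⟨
      suc ∣ edge e ∩ (U - v) ∣     ≡⟨ cong suc (toℕ-index e (U - v)) ⟨
      suc (toℕ (index e (U - v)))  ∎
  ... | no v∉e = begin
    edgeWeight e T -ℝ edgeWeight e (T - v)
      ≈⟨ marginal-outside e T v (v∉e ∘ proj₁ ∘ x∈p∩q⁻ (edge e) T) ⟩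
    0ℝ
      ≈⟨ marginal-outside e S v (v∉e ∘ proj₁ ∘ x∈p∩q⁻ (edge e) S) ⟨
    edgeWeight e S -ℝ edgeWeight e (S - v)  ∎
    where open ≤ℝ-Reasoning

  -- For v ∈ e ∩ S the nonnegative subtracted weight is dropped; otherwise the marginal vanishes.
  -- The indicator form prepares the count of e ∩ S when summing over vertices.
  marginal≤ : ∀ e S v →
    edgeWeight e S -ℝ edgeWeight e (S - v) ≤ℝ (if lookup (edge e ∩ S) v then edgeWeight e S else 0ℝ)
  marginal≤ e S v = by-cases (lookup (edge e ∩ S) v) refl
    where
    by-cases : ∀ b → lookup (edge e ∩ S) v ≡ b →
               edgeWeight e S -ℝ edgeWeight e (S - v) ≤ℝ (if b then edgeWeight e S else 0ℝ)
    by-cases true  _  = x-y≤x {edgeWeight e S} {edgeWeight e (S - v)}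
      (weight-nonneg e (index e (S - v)))
    by-cases false eq = ≤ℝ-reflexive {edgeWeight e S -ℝ edgeWeight e (S - v)} {0ℝ}
      (marginal-outside e S v λ v∈e∩S → contradiction (trans (sym eq) ([]=⇒lookup v∈e∩S)) λ ())

  loss≐∑marginal : ∀ S v → loss S v ≐ ∑ℝ (λ e → edgeWeight e S -ℝ edgeWeight e (S - v))
  loss≐∑marginal S v n = ∑ℝ-distrib-- (λ e → edgeWeight e S) (λ e → edgeWeight e (S - v)) n

  -- This is supermodularity of `F`, obtained edge by edge.
  loss-mono : ∀ {T S v} → T ⊆ S → v ∈ T → loss T v ≤ℝ loss S v
  loss-mono {T} {S} {v} T⊆S v∈T = begin
    loss T v
      ≈⟨ loss≐∑marginal T v ⟩
    ∑ℝ (λ e → edgeWeight e T -ℝ edgeWeight e (T - v))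
      ≲⟨ ∑ℝ-mono-≤ (λ e → marginal-mono e T⊆S v∈T) ⟩
    ∑ℝ (λ e → edgeWeight e S -ℝ edgeWeight e (S - v))
      ≈⟨ loss≐∑marginal S v ⟨
    loss S v ∎
    where open ≤ℝ-Reasoning

  ∣e∣≤rank : ∀ e → ∣ edge e ∣ ℕ.≤ rank H
  ∣e∣≤rank e = v≤max⁺ 0 _ (inj₂ (tabulate⁺ e ℕ.≤-refl))

  -- Double counting: the minimal loss is at most each loss in `S`, and after the sums are exchanged
  -- an edge contributes its weight ∣ e ∩ S ∣ times, hence at most `rank H` times.
  ∣S∣·loss≤rank·F : ∀ {S v} → IsArgminLoss S v → ∣ S ∣ · loss S v ≤ℝ rank H · F S
  ∣S∣·loss≤rank·F {S} {v} (_ , loss-min) = begin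
    ∣ S ∣ · loss S v
      ≈⟨ ∑ℝ-indicator S (loss S v) ⟨
    ∑ℝ (λ u → if lookup S u then loss S v else 0ℝ)
      ≲⟨ ∑ℝ-mono-≤ min≤loss ⟩
    ∑ℝ (λ u → loss S u)
      ≈⟨ sum-cong-≋ (loss≐∑marginal S) ⟩
    ∑ℝ (λ u → ∑ℝ (λ e → edgeWeight e S -ℝ edgeWeight e (S - u)))
      ≲⟨ ∑ℝ-mono-≤ (λ u → ∑ℝ-mono-≤ (λ e → marginal≤ e S u)) ⟩
    ∑ℝ (λ u → ∑ℝ (λ e → if lookup (edge e ∩ S) u then edgeWeight e S else 0ℝ))
      ≈⟨ ∑-comm (λ u e → if lookup (edge e ∩ S) u then edgeWeight e S else 0ℝ) ⟩
    ∑ℝ (λ e → ∑ℝ (λ u → if lookup (edge e ∩ S) u then edgeWeight e S else 0ℝ))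
      ≈⟨ sum-cong-≋ (λ e → ∑ℝ-indicator (edge e ∩ S) (edgeWeight e S)) ⟩
    ∑ℝ (λ e → ∣ edge e ∩ S ∣ · edgeWeight e S)
      ≲⟨ ∑ℝ-mono-≤ (λ e → ·-monoˡ-≤ (edgeWeight e S) (weight-nonneg e (index e S))
           (ℕ.≤-trans (∣p∩q∣≤∣p∣ (edge e) S) (∣e∣≤rank e))) ⟩
    ∑ℝ (λ e → rank H · edgeWeight e S)
      ≈⟨ ∑ℝ-distrib-· (rank H) (λ e → edgeWeight e S) ⟩
    rank H · F S ∎
    where
    open ≤ℝ-Reasoning
    min≤loss : ∀ u → (if lookup S u then loss S v else 0ℝ) ≤ℝ loss S u
    min≤loss u = by-cases (lookup S u) refl
      where
      by-cases : ∀ b → lookup S u ≡ b → (if b then loss S v else 0ℝ) ≤ℝ loss S u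
      by-cases true  eq = loss-min u (lookup⇒[]= u S eq)
      -- A vertex outside `S` has loss 0, so extending the sum from `S` to all vertices adds
      -- nothing.
      by-cases false eq = ≤ℝ-reflexive {0ℝ} {loss S u} λ k → sym (trans
        (cong (λ U → seq (F S -ℝ F U) k) (x∉p⇒p-x≡p
          λ u∈S → contradiction (trans (sym eq) ([]=⇒lookup u∈S)) λ ()))
        (ℚ.+-inverseʳ (seq (F S) k)))

  -- Base of the peeling: every edge meets the empty set at index 0.
  F⊥≤0 : F ⊥ ≤ℝ 0ℝ
  F⊥≤0 = begin
    F ⊥                         ≲⟨ ∑ℝ-mono-≤ edge⊥≤0 ⟩
    ∑ℝ (λ (_ : Fin m) → 0ℝ)     ≈⟨ sum-replicate-zero m ⟩
    0ℝ                          ∎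
    where
    open ≤ℝ-Reasoning
    index⊥≡0 : ∀ e → index e ⊥ ≡ zero
    index⊥≡0 e = toℕ-injective (trans (toℕ-index e ⊥)
      (trans (cong ∣_∣ (∩-zeroʳ (edge e))) (∣⊥∣≡0 n)))
    edge⊥≤0 : ∀ e → edgeWeight e ⊥ ≤ℝ 0ℝ
    edge⊥≤0 e = subst (λ i → weight H e i ≤ℝ 0ℝ) (sym (index⊥≡0 e)) (proj₁ (f0≈0 e))

  -- Executions of the loop.

  density-nondecreasing : ∀ {S S′ R} → Loop S S′ R → density H S′ ≤ℝ density H R
  density-nondecreasing {S′ = S′} (stop _) = ≤ℝ-refl (density H S′)
  density-nondecreasing {S} {S′} {R} (update v _ (S-v≢∅ , S′<S-v) run) = begin
    density H S′               ≲⟨ <ℝ⇒≤ℝ {density H S′} {density H (S - v , S-v≢∅)} S′<S-v ⟩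
    density H (S - v , S-v≢∅)  ≲⟨ density-nondecreasing run ⟩
    density H R                ∎
    where open ≤ℝ-Reasoning
  density-nondecreasing (keep _ _ _ run) = density-nondecreasing run

  -- The density bound turns the averaging estimate into ∣ S ∣ · loss S v ≤ ∣ S ∣ · (rank H · d),
  -- and ∣ S ∣ cancels because `v` lies in `S`.
  argmin-loss≤ : ∀ {S v} d → IsArgminLoss S v →
                 (∀ S≢∅ → density H (S , S≢∅) ≤ℝ d) → loss S v ≤ℝ rank H · d
  argmin-loss≤ {S} {v} d argmin density≤d = ·-cancelˡ-≤ ∣ S ∣ {loss S v} {rank H · d} (begin
    ∣ S ∣ · loss S v        ≲⟨ ∣S∣·loss≤rank·F argmin ⟩
    rank H · F S            ≲⟨ ·-monoʳ-≤ (rank H) {F S} {∣ S ∣ · d}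
                                 (x÷k≤y⇒x≤k·y ∣ S ∣ {F S} {d} (density≤d S≢∅)) ⟩
    rank H · (∣ S ∣ · d)    ≈⟨ ·-leftComm (rank H) ∣ S ∣ d ⟩
    ∣ S ∣ · (rank H · d)    ∎)
    where
    open ≤ℝ-Reasoning
    S≢∅ : Nonempty S
    S≢∅ = v , proj₁ argmin
    instance
      ∣S∣≢0 : NonZero ∣ S ∣
      ∣S∣≢0 = nonempty⇒∣S∣≢0 S≢∅

  -- If v ∉ T, then `T` survives inside `S - v`. Otherwise removing `v` costs `T` at most loss S v ≤
  -- c by supermodularity, and the remainder `T - v` lies inside `S - v`.
  F-step : ∀ {T S v c} → T ⊆ S → loss S v ≤ℝ c →
           (∀ {U} → U ⊆ S - v → F U ≤ℝ ∣ U ∣ · c) → F T ≤ℝ ∣ T ∣ · c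
  F-step {T} {S} {v} {c} T⊆S loss≤c F≤ with v ∈? T
  ... | no v∉T  = F≤ λ {x} x∈T → x∈p∧x≢y⇒x∈p-y (T⊆S x∈T) λ { refl → v∉T x∈T }
  ... | yes v∈T = subst (λ k → F T ≤ℝ k · c) (x∈p⇒1+∣p-x∣≡∣p∣ v∈T) (begin
    F T                   ≲⟨ x-y≤z⇒x≤z+y {F T} {F (T - v)} {c}
                               (≤ℝ-trans {loss T v} {loss S v} {c} (loss-mono T⊆S v∈T) loss≤c) ⟩
    c +ℝ F (T - v)        ≲⟨ +ℝ-mono-≤ {c} {c} {F (T - v)} {∣ T - v ∣ · c} (≤ℝ-refl c)
                               (F≤ T-v⊆S-v) ⟩
    c +ℝ ∣ T - v ∣ · c    ∎)
    where
    open ≤ℝ-Reasoning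
    T-v⊆S-v : T - v ⊆ S - v
    T-v⊆S-v x∈T-v =
      x∈p∧x≢y⇒x∈p-y (T⊆S (p─q⊆p T ⁅ v ⁆ x∈T-v)) λ { refl → x∉p-x T x∈T-v }

  -- Induction on the execution. The invariant is that the candidate `S′` is at least as dense as
  -- the current `S`; quantified over proofs of nonemptiness, it is vacuous once `S` is empty. The
  -- final density of `R` gives one threshold valid at every step.
  F≤∣T∣·rank·density : ∀ {S S′ R} → Loop S S′ R →
    (∀ S≢∅ → density H (S , S≢∅) ≤ℝ density H S′) →
    ∀ {T} → T ⊆ S → F T ≤ℝ ∣ T ∣ · (rank H · density H R)
  F≤∣T∣·rank·density {R = R} (stop S≡∅) _ {T} T⊆S =
    subst (λ U → F U ≤ℝ ∣ U ∣ · c) (sym (Empty-unique λ (x , x∈T) → S≡∅ (x , T⊆S x∈T))) F⊥≤∣⊥∣·c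
    where
    c = rank H · density H R
    F⊥≤∣⊥∣·c : F ⊥ ≤ℝ ∣ ⊥ {n} ∣ · c
    F⊥≤∣⊥∣·c = subst (λ k → F ⊥ ≤ℝ k · c) (sym (∣⊥∣≡0 n)) F⊥≤0
  F≤∣T∣·rank·density {S} {S′} {R} loop@(update v argmin (S-v≢∅ , _) run) S≤S′ T⊆S =
    F-step {c = rank H · density H R} T⊆S
      (argmin-loss≤ (density H R) argmin λ S≢∅ →
        ≤ℝ-trans {density H (S , S≢∅)} {density H S′} {density H R}
          (S≤S′ S≢∅) (density-nondecreasing loop))
      -- The new candidate is the new state itself; the nonzero divisor proof is irrelevant in
      -- `_÷ℝ_`, so reflexivity covers every proof of nonemptiness.
      (F≤∣T∣·rank·density run λ _ → ≤ℝ-refl (density H (S - v , S-v≢∅)))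
  F≤∣T∣·rank·density {S} {S′} {R} loop@(keep v argmin ¬imp run) S≤S′ T⊆S =
    F-step {c = rank H · density H R} T⊆S
      (argmin-loss≤ (density H R) argmin λ S≢∅ →
        ≤ℝ-trans {density H (S , S≢∅)} {density H S′} {density H R}
          (S≤S′ S≢∅) (density-nondecreasing loop))
      -- A rejected update only denies a strict improvement; stability of the order restores the
      -- invariant.
      (F≤∣T∣·rank·density run λ S-v≢∅ →
        ≮ℝ⇒≥ℝ {density H (S - v , S-v≢∅)} {density H S′} λ S′<S-v → ¬imp (S-v≢∅ , S′<S-v))

-- The approximation ratio, passing from single sets to the maximum.

theorem4 : (H : Hypergraph) →
    (∀ e → NonDecreasing (weight H e)) →
    (∀ e → Convex (weight H e)) →
    (∀ e → weight H e zero ≈ℝ 0ℝ) →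
    ∀ S′ → GDSH-Approx-Returns H S′ →
    (maxDensity H ÷ℝ rank H) {{rank≢0 H}} ≤ℝ density H S′
theorem4 H _ convex f0≈0 S′ run =
  x≤k·y⇒x÷k≤y (rank H) {{rank≢0 H}} {maxDensity H} {density H S′}
    -- The maximum is a fold of joins, so it suffices to bound its initial value, the density of V,
    -- and each listed density.
    (foldr-preservesᵇ {P = _≤ℝ rank H · density H S′}
      (λ {x} {y} → ⊔ℝ-lub {x} {y} {rank H · density H S′})
      (density≤ (Hypergraph.V H))
      (All.map⁺ (All.universal density≤ (nonemptySubsets (Hypergraph.n H)))))
  where
  open Peeling H convex f0≈0
  density≤ : ∀ T → density H T ≤ℝ rank H · density H S′
  density≤ (T , T≢∅) =
    x≤k·y⇒x÷k≤y ∣ T ∣ {{nonempty⇒∣S∣≢0 T≢∅}} {Hypergraph.F H T} {rank H · density H S′}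
      -- The loop starts with both variables equal to V, so the invariant holds by reflexivity and
      -- every `T` is admissible.
      (F≤∣T∣·rank·density run (λ _ → ≤ℝ-refl (density H (Hypergraph.V H))) ⊆⊤)
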